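{- Let $G=(V,E)$ be a finite connected graph with $n$ vertices and maximal degree $\Delta$. Then $\mathcal{AC}(G) \leq 20\,\Delta\, n$.
   Context: Acquaintance time: let $G=(V,E)$ be a finite connected graph. Initially one agent is placed on each vertex. At any moment, two agents located at the endpoints of a common edge become acquainted (this applies to the initial placement and to the placement after every round). In each round one chooses a matching of $G$ (not necessarily maximal), and for each edge of the matching the two agents on its endpoints swap places. A sequence of matchings after which every pair of agents has been acquainted at some moment is a strategy for acquaintance in $G$. The acquaintance time $\mathcal{AC}(G)$ is the minimal number of rounds (matchings) in a strategy for acquaintance in $G$. -}

module Defs where

open import Data.Nat using (ℕ; _⊔_)
open import Data.Fin using (Fin)
open import Data.List using (List; []; _∷_; length; filter; map; foldr; allFin)
open import Data.List.Relation.Unary.Any using (Any)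
open import Data.Product using (Σ; ∃; ∃₂; _×_; _,_)
open import Data.Sum using (_⊎_)
open import Function using (_∘_; id)
open import Relation.Nullary using (¬_; Dec)
open import Relation.Binary.PropositionalEquality using (_≡_)
open import Relation.Binary.Construct.Closure.ReflexiveTransitive using (Star)

record Graph (n : ℕ) : Set₁ where
  field
    Adj    : Fin n → Fin n → Set
    adj?   : ∀ u v → Dec (Adj u v)
    sym    : ∀ {u v} → Adj u v → Adj v u
    irrefl : ∀ {u} → ¬ Adj u u
open Graph public

Connected : ∀ {n} → Graph n → Set
Connected G = ∀ u v → Star (Adj G) u v

degree : ∀ {n} → Graph n → Fin n → ℕ
degree G v = length (filter (adj? G v) (allFin _))

maxDegree : ∀ {n} → Graph n → ℕ
maxDegree G = foldr _⊔_ 0 (map (degree G) (allFin _))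

-- A matching of G, encoded as an involution σ of the vertex set that fixes
-- unmatched vertices and sends each matched vertex to its partner along an edge.
record Matching {n : ℕ} (G : Graph n) : Set where
  field
    σ      : Fin n → Fin n
    invol  : ∀ v → σ (σ v) ≡ v
    onEdge : ∀ v → σ v ≡ v ⊎ Adj G v (σ v)
open Matching public

-- A placement p assigns to each vertex the agent (named by its initial vertex)
-- standing on it. Applying a matching swaps the agents on matched edges.
-- placements p Ms = the list of placements at times 0,1,…,length Ms.
placements : ∀ {n} {G : Graph n} → (Fin n → Fin n) → List (Matching G) → List (Fin n → Fin n)
placements p []       = p ∷ []
placements p (M ∷ Ms) = p ∷ placements (p ∘ σ M) Ms

AcquaintedIn : ∀ {n} → Graph n → (Fin n → Fin n) → Fin n → Fin n → Set
AcquaintedIn G p a b = ∃₂ λ u v → Adj G u v × p u ≡ a × p v ≡ b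

IsAcquaintanceStrategy : ∀ {n} (G : Graph n) → List (Matching G) → Set
IsAcquaintanceStrategy G Ms =
  ∀ a b → ¬ a ≡ b → Any (λ p → AcquaintedIn G p a b) (placements id Ms)

-- AC(G) ≤ k : there is a strategy for acquaintance using at most k matchings
-- (unfolding of "the minimal number of rounds of a strategy is ≤ k").
ACAtMost : ∀ {n} → Graph n → ℕ → Set
ACAtMost G k = Σ (List (Matching G)) λ Ms → IsAcquaintanceStrategy G Ms × length Ms Data.Nat.≤ k

{-# OPTIONS --safe #-}
-- The vertices are put on a line so that consecutive ones lie at distance at most 3,
-- joined by short paths ("links"). The line grows one vertex v at a time: next to a
-- neighbour u of v, after u if the link leaving u starts with an edge at u, and before u
-- otherwise; this prolongs one old link by v and creates the link {u,v}. Few links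
-- pass through u, so maxDegree + 1 colours suffice to keep links of equal colour disjoint.
--
-- Three matchings exchange the ends of all links of one colour, bringing the two agents
-- of each to adjacent vertices. Going through the colours, 3 (maxDegree + 1) matchings
-- simulate one round of odd-even transposition on the line. Two agents keep their order
-- on the line until they meet, and each agent reaches the last position within 2 n rounds,
-- so all pairs meet after 6 n (maxDegree + 1) ≤ 12 n maxDegree matchings.
module Submission where

open import Defs
open import Data.Nat using (ℕ; zero; suc; _+_; pred; _*_; _∸_; _≤_; _<_; z≤n; s≤s; s≤s⁻¹)
open import Data.Nat.Properties
open import Data.Nat.Solver using (module +-*-Solver)
open import Data.Fin using (Fin; zero; suc)
import Data.Fin.Properties as Fin
open import Data.Fin.Permutation.Components using (transpose)
open import Data.Bool using (Bool; true; not)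
import Data.Bool.Properties as Bool
open import Data.Empty using (⊥-elim)
open import Data.List using (List; []; _∷_; [_]; _++_; length; map; allFin; upTo)
open import Data.List.Properties using (length-++; length-map; length-tabulate; foldr-preservesᵒ; length-upTo)
open import Data.List.Relation.Unary.Any as Any using (Any; here; there)
open import Data.List.Relation.Unary.All as All using (All; []; _∷_)
open import Data.List.Relation.Unary.AllPairs using (AllPairs; []; _∷_)
import Data.List.Relation.Unary.AllPairs.Properties as AllPairsₚ
open import Data.List.Relation.Unary.Unique.Propositional using (Unique)
open import Data.List.Relation.Unary.Unique.Propositional.Properties using (upTo⁺)
open import Data.List.Membership.Propositional using (_∈_; _∉_)
open import Data.List.Membership.Propositional.Properties
  using (∈-∃++; ∈-++⁻; ∈-++⁺ˡ; ∈-++⁺ʳ; ∈-map⁺; ∈-map⁻; ∈-filter⁺; ∈-allFin; ∈-upTo⁻; ∈-AllPairs₂)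
import Data.List.Membership.DecPropositional as DecMembership
open import Data.Product using (∃; ∃₂; _×_; _,_; proj₁; proj₂)
open import Data.Sum using (_⊎_; inj₁; inj₂; [_,_]′)
open import Function using (_∘_; id)
open import Relation.Nullary using (¬_; Dec; yes; no; ¬?; contradiction)
open import Relation.Nullary.Decidable using (dec-true; dec-false; _×-dec_)
open import Relation.Binary.Definitions using (tri<; tri≈; tri>)
open import Relation.Binary.PropositionalEquality
  using (_≡_; _≢_; refl; trans; cong; cong₂; subst; subst₂; module ≡-Reasoning) renaming (sym to ≡-sym)
open import Relation.Binary.Construct.Closure.ReflexiveTransitive using (Star; ε; _◅_)

-- Lists: pigeonhole, splicing, indexing

module _ {A : Set} where

  Unique-⊆⇒length≤ : ∀ {xs ys : List A} → Unique xs → (∀ {z} → z ∈ xs → z ∈ ys) → length xs ≤ length ys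
  Unique-⊆⇒length≤ [] _ = z≤n
  Unique-⊆⇒length≤ {x ∷ xs} (x∉ ∷ u) xs⊆ys with as , bs , refl ← ∈-∃++ (xs⊆ys (here refl)) = begin
    suc (length xs)             ≤⟨ s≤s (Unique-⊆⇒length≤ u sub) ⟩
    suc (length (as ++ bs))     ≡⟨ cong suc (length-++ as) ⟩
    suc (length as + length bs) ≡⟨ +-suc (length as) (length bs) ⟨
    length as + suc (length bs) ≡⟨ length-++ as ⟨
    length (as ++ x ∷ bs)       ∎
    where
    open ≤-Reasoning
    sub : ∀ {z} → z ∈ xs → z ∈ as ++ bs
    sub z∈xs with ∈-++⁻ as (xs⊆ys (there z∈xs))
    ... | inj₁ z∈as         = ∈-++⁺ˡ z∈as
    ... | inj₂ (here refl)  = contradiction refl (All.lookup x∉ z∈xs)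
    ... | inj₂ (there z∈bs) = ∈-++⁺ʳ as z∈bs

  splice : A → A → ∀ {x} {xs : List A} → x ∈ xs → List A
  splice a b {xs = _ ∷ xs} (here _)  = a ∷ b ∷ xs
  splice a b {xs = y ∷ _}  (there p) = y ∷ splice a b p

  module _ (a b : A) {x : A} where

    splice-∈⁻ : ∀ {xs} (p : x ∈ xs) {z} → z ∈ splice a b p → z ≡ a ⊎ z ≡ b ⊎ z ∈ xs
    splice-∈⁻ (here _)  (here eq)         = inj₁ eq
    splice-∈⁻ (here _)  (there (here eq)) = inj₂ (inj₁ eq)
    splice-∈⁻ (here _)  (there (there q)) = inj₂ (inj₂ (there q))
    splice-∈⁻ (there p) (here eq)         = inj₂ (inj₂ (here eq))
    splice-∈⁻ (there p) (there q) with splice-∈⁻ p q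
    ... | inj₁ eq        = inj₁ eq
    ... | inj₂ (inj₁ eq) = inj₂ (inj₁ eq)
    ... | inj₂ (inj₂ r)  = inj₂ (inj₂ (there r))

    splice-∈ˡ : ∀ {xs} (p : x ∈ xs) → a ∈ splice a b p
    splice-∈ˡ (here _)  = here refl
    splice-∈ˡ (there p) = there (splice-∈ˡ p)

    splice-∈ʳ : ∀ {xs} (p : x ∈ xs) → b ∈ splice a b p
    splice-∈ʳ (here _)  = there (here refl)
    splice-∈ʳ (there p) = there (splice-∈ʳ p)

    splice-∈⁺ : ∀ {xs} (p : x ∈ xs) {z} → z ∈ xs → z ≡ x ⊎ z ∈ splice a b p
    splice-∈⁺ (here refl) (here eq) = inj₁ eq
    splice-∈⁺ (here _)    (there q) = inj₂ (there (there q))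
    splice-∈⁺ (there p)   (here eq) = inj₂ (here eq)
    splice-∈⁺ (there p)   (there q) with splice-∈⁺ p q
    ... | inj₁ eq = inj₁ eq
    ... | inj₂ r  = inj₂ (there r)

    splice-All : ∀ {P : A → Set} {xs} (p : x ∈ xs) → P a → P b → All P xs → All P (splice a b p)
    splice-All p Pa Pb ps = All.tabulate λ q → [ (λ { refl → Pa }) , [ (λ { refl → Pb }) , All.lookup ps ]′ ]′ (splice-∈⁻ p q)

    splice-AllPairs : ∀ {R : A → A → Set} {xs} (p : x ∈ xs) → (∀ {k l} → R k l → R l k) → R a b →
      (∀ {k} → k ∈ xs → R k x → R k a × R k b) → AllPairs R xs → AllPairs R (splice a b p)
    splice-AllPairs (here refl) R-sym Rab lift (rs ∷ rss) =
      (Rab ∷ All.tabulate λ q → R-sym (proj₁ (lift (there q) (R-sym (All.lookup rs q))))) ∷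
      All.tabulate (λ q → R-sym (proj₂ (lift (there q) (R-sym (All.lookup rs q))))) ∷ rss
    splice-AllPairs (there p) R-sym Rab lift (rs ∷ rss) =
      let Rya , Ryb = lift (here refl) (All.lookup rs p) in
      splice-All p Rya Ryb rs ∷ splice-AllPairs p R-sym Rab (lift ∘ there) rss

open DecMembership _≟_ using () renaming (_∈?_ to _∈ℕ?_)

-- Total, with a default value, so that positions on the line are plain naturals open to arithmetic
-- and parity; bounds are separate hypotheses.
nth : ∀ {A : Set} → A → List A → ℕ → A
nth d []       _       = d
nth d (x ∷ xs) zero    = x
nth d (x ∷ xs) (suc i) = nth d xs i

module _ {A : Set} {d : A} where

  nth-∈ : ∀ {xs i} → i < length xs → nth d xs i ∈ xs
  nth-∈ {x ∷ xs} {zero}  _       = here refl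
  nth-∈ {x ∷ xs} {suc i} (s≤s p) = there (nth-∈ p)

  ∈-nth : ∀ {xs x} → x ∈ xs → ∃ λ i → i < length xs × nth d xs i ≡ x
  ∈-nth (here refl) = 0 , s≤s z≤n , refl
  ∈-nth (there p) = let i , i< , e = ∈-nth p in suc i , s≤s i< , e

  nth-injective : ∀ {xs i j} → Unique xs → i < length xs → j < length xs → nth d xs i ≡ nth d xs j → i ≡ j
  nth-injective {_ ∷ _} {zero}  {zero}  _        _       _       _ = refl
  nth-injective {_ ∷ _} {zero}  {suc j} (x∉ ∷ _) _       (s≤s q) e = contradiction e (All.lookup x∉ (nth-∈ q))
  nth-injective {_ ∷ _} {suc i} {zero}  (x∉ ∷ _) (s≤s p) _       e = contradiction (≡-sym e) (All.lookup x∉ (nth-∈ p))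
  nth-injective {_ ∷ _} {suc i} {suc j} (_ ∷ u)  (s≤s p) (s≤s q) e = cong suc (nth-injective u p q e)

-- Pigeonhole: otherwise the `suc k` distinct colours from 0 to `k` would all lie in a list of
-- length at most `k`. This is the greedy colouring step.
fresh-below : ∀ k (xs : List ℕ) → length xs ≤ k → ∃ λ c → c ≤ k × c ∉ xs
fresh-below k xs len with anyUpTo? (λ c → ¬? (c ∈ℕ? xs)) (suc k)
... | yes (c , s≤s c≤k , c∉xs) = c , c≤k , c∉xs
... | no none = contradiction len (<⇒≱ (subst (_≤ length xs) (length-upTo (suc k)) (Unique-⊆⇒length≤ (upTo⁺ (suc k)) all∈)))
  where
  all∈ : ∀ {c} → c ∈ upTo (suc k) → c ∈ xs
  all∈ {c} p with c ∈ℕ? xs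
  ... | yes q = q
  ... | no c∉ = contradiction (c , ∈-upTo⁻ p , c∉) none

-- Links and chains of links

-- A link joins two consecutive vertices src, tgt of a linear order on the
-- vertices through an edge {src′, tgt′}; each end is that of the edge or next to it.
record Link (n : ℕ) : Set where
  constructor link
  field
    src src′ tgt′ tgt : Fin n
    colour            : ℕ

  verts : List (Fin n)
  verts = src ∷ src′ ∷ tgt′ ∷ tgt ∷ []

  -- A site is an end of the link lying on the middle edge itself. Such an end can be moved on to a
  -- new neighbour while the path keeps at most three edges.
  SrcSite TgtSite : Fin n → Set
  SrcSite z = src ≡ z × src′ ≡ z
  TgtSite z = tgt′ ≡ z × tgt ≡ z

open Link

data Chain {n} : Fin n → List (Link n) → Set where
  []  : ∀ {r} → Chain r []
  _∷_ : ∀ {r l ls} → src l ≡ r → Chain (tgt l) ls → Chain r (l ∷ ls)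

Clash : ∀ {n} → Link n → Link n → Set
Clash k l = colour k ≡ colour l × ∃ λ z → z ∈ verts k × z ∈ verts l

splice-Chain : ∀ {n} {a b l : Link n} {r ls} (p : l ∈ ls) →
  src a ≡ src l → tgt a ≡ src b → tgt b ≡ tgt l → Chain r ls → Chain r (splice a b p)
splice-Chain (here refl) ea eab eb (e ∷ c) = trans ea e ∷ (≡-sym eab ∷ subst (λ t → Chain t _) (≡-sym eb) c)
splice-Chain (there p) ea eab eb (e ∷ c) = e ∷ splice-Chain p ea eab eb c

trail : ∀ {n} → Fin n → List (Link n) → List (Fin n)
trail r ls = r ∷ map tgt ls

Chain-src : ∀ {n r ls d i} {e : Fin n} → Chain r ls → i < length ls → src (nth d ls i) ≡ nth e (trail r ls) i
Chain-src {ls = _ ∷ _} {i = zero}  (eq ∷ _) _       = eq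
Chain-src {ls = _ ∷ ls} {i = suc i} (_ ∷ c)  (s≤s p) = Chain-src {ls = ls} c p

nth-tgt : ∀ {n ls d i} {e : Fin n} → i < length ls → tgt (nth d ls i) ≡ nth e (map tgt ls) i
nth-tgt {ls = _ ∷ _} {i = zero}  _       = refl
nth-tgt {ls = _ ∷ ls} {i = suc i} (s≤s p) = nth-tgt {ls = ls} p

module _ {n : ℕ} where

  transpose-fst : ∀ (i j : Fin n) → transpose i j i ≡ j
  transpose-fst i j rewrite dec-true (i Fin.≟ i) refl = refl

  transpose-snd : ∀ (i j : Fin n) → transpose i j j ≡ i
  transpose-snd i j with j Fin.≟ i
  ... | yes j≡i = j≡i
  ... | no _ rewrite dec-true (j Fin.≟ j) refl = refl

  transpose-other : ∀ {i j k : Fin n} → k ≢ i → k ≢ j → transpose i j k ≡ k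
  transpose-other {i} {j} {k} k≢i k≢j rewrite dec-false (k Fin.≟ i) k≢i | dec-false (k Fin.≟ j) k≢j = refl

  -- `outer` swaps along both end edges at once, and is the identity at an end without such an edge.
  -- Conjugating `inner` by it gives the transposition of `src` and `tgt`.
  outer inner : Link n → Fin n → Fin n
  outer l v = transpose (src l) (src′ l) (transpose (tgt′ l) (tgt l) v)
  inner l v = transpose (src′ l) (tgt′ l) v

parity : ℕ → Bool
parity zero    = true
parity (suc i) = not (parity i)

-- Layouts: coloured links along a line of vertices

module _ {n : ℕ} (G : Graph n) where

  open DecMembership (Fin._≟_ {n}) using (_∈?_)

  degree≤maxDegree : ∀ v → degree G v ≤ maxDegree G
  degree≤maxDegree v = foldr-preservesᵒ {P = degree G v ≤_}
    (λ x y → [ m≤n⇒m≤n⊔o y , m≤n⇒m≤o⊔n x ]′) 0 (map (degree G) (allFin n))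
    (inj₂ (Any.map ≤-reflexive (∈-map⁺ (degree G) (∈-allFin v))))

  neighbours≤maxDegree : ∀ {v ws} → Unique ws → All (Adj G v) ws → length ws ≤ maxDegree G
  neighbours≤maxDegree {v} u as = ≤-trans
    (Unique-⊆⇒length≤ u (λ p → ∈-filter⁺ (adj? G v) (∈-allFin _) (All.lookup as p)))
    (degree≤maxDegree v)

  record Good (l : Link n) : Set where
    field
      srcs      : src l ≡ src′ l ⊎ Adj G (src l) (src′ l)
      tgts      : tgt l ≡ tgt′ l ⊎ Adj G (tgt l) (tgt′ l)
      core      : Adj G (src′ l) (tgt′ l)
      src≢tgt   : src l ≢ tgt l
      src≢tgt′  : src l ≢ tgt′ l
      src′≢tgt  : src′ l ≢ tgt l

    src′≢tgt′ : src′ l ≢ tgt′ l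
    src′≢tgt′ eq = irrefl G (subst (Adj G _) (≡-sym eq) core)

  -- The number of colours at z never exceeds that of its neighbours on the line by more than
  -- one, so below the full degree a colour is free.
  record Palette (r : Fin n) (ls : List (Link n)) (z : Fin n) : Set where
    field
      colours     : List ℕ
      nbrs        : List (Fin n)
      covers      : ∀ {l} → l ∈ ls → z ∈ verts l → colour l ∈ colours
      nbrs-unique : Unique nbrs
      nbrs-adj    : All (Adj G z) nbrs
      nbrs-trail  : ∀ {w} → w ∈ nbrs → w ∈ trail r ls
      few         : length colours ≤ suc (length nbrs)

  -- The invariant of the growing line. `site` lets a vertex be inserted next to any vertex of the
  -- line without making a link too long, `inside` keeps a vertex off the line off all links, and
  -- `palette` provides a free colour.
  record Layout (r : Fin n) (ls : List (Link n)) : Set where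
    field
      chain    : Chain r ls
      good     : All Good ls
      inside   : ∀ {l z} → l ∈ ls → z ∈ verts l → z ∈ trail r ls
      distinct : Unique (trail r ls)
      site     : ∀ {z} → z ∈ trail r ls → ∃ λ l → l ∈ ls × (SrcSite l z ⊎ TgtSite l z)
      proper   : AllPairs (λ k l → ¬ Clash k l) ls
      bounded  : All (λ l → colour l ≤ maxDegree G) ls
      palette  : ∀ {z} → z ∈ trail r ls → Palette r ls z

  initial : ∀ {r w} → Adj G r w → Layout r [ link r r w w 0 ]
  initial {r} {w} r∼w = record
    { chain    = refl ∷ []
    ; good     = record { srcs = inj₁ refl ; tgts = inj₁ refl ; core = r∼w
                        ; src≢tgt = r≢w ; src≢tgt′ = r≢w ; src′≢tgt = r≢w } ∷ []
    ; inside   = λ where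
        (here refl) (here refl)                         → here refl
        (here refl) (there (here refl))                 → here refl
        (here refl) (there (there (here refl)))         → there (here refl)
        (here refl) (there (there (there (here refl)))) → there (here refl)
    ; distinct = (r≢w ∷ []) ∷ ([] ∷ [])
    ; site     = λ where
        (here refl)         → _ , here refl , inj₁ (refl , refl)
        (there (here refl)) → _ , here refl , inj₂ (refl , refl)
    ; proper   = [] ∷ []
    ; bounded  = z≤n ∷ []
    -- One colour and no listed neighbour meet `few` with equality; each later insertion next to a
    -- vertex adds one colour and one neighbour to its lists.
    ; palette  = λ _ → record
        { colours = [ 0 ] ; nbrs = [] ; covers = λ { (here refl) _ → here refl }
        ; nbrs-unique = [] ; nbrs-adj = [] ; nbrs-trail = λ () ; few = ≤-refl }
    }
    where
    r≢w : r ≢ w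
    r≢w refl = irrefl G r∼w

  -- Inserting a vertex into a layout

  -- Inserting v, a neighbour of the trail vertex u, replaces a link l at u by a, b:
  -- one of them is the edge {u,v} with a new colour c, the other is l prolonged to v.
  module Insert {r ls} (S : Layout r ls) {u v} (u∈ : u ∈ trail r ls) (u∼v : Adj G u v) (v∉ : v ∉ trail r ls) where
    open Layout S
    open Palette (palette u∈) using () renaming (colours to used)

    IsNew : ℕ → Link n → Set
    IsNew c k = colour k ≡ c × (∀ {z} → z ∈ verts k → z ≡ u ⊎ z ≡ v)

    Prolongs : Link n → Link n → Set
    Prolongs l k = colour k ≡ colour l × (∀ {z} → z ∈ verts k → z ≡ v ⊎ z ∈ verts l)

    record Split (l : Link n) (c : ℕ) (a b : Link n) : Set where
      field
        src-a  : src a ≡ src l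
        tgt-a  : tgt a ≡ v
        src-b  : src b ≡ v
        tgt-b  : tgt b ≡ tgt l
        good-a : Good a
        good-b : Good b
        site-a : ∀ {z} → SrcSite l z → SrcSite a z
        site-b : ∀ {z} → TgtSite l z → TgtSite b z
        site-v : TgtSite a v ⊎ SrcSite b v
        u∈l    : u ∈ verts l
        roles  : (IsNew c a × Prolongs l b) ⊎ (Prolongs l a × IsNew c b)

    v∉verts : ∀ {l} → l ∈ ls → v ∉ verts l
    v∉verts l∈ = v∉ ∘ inside l∈

    u≢v : u ≢ v
    u≢v refl = v∉ u∈

    -- In both cases the prolonged link spends its free end at `u`, while the new link, a single
    -- edge, is a site for `u` as well as for `v`. Hence both stay open to further insertions.
    split : ∀ {l} → l ∈ ls → SrcSite l u ⊎ TgtSite l u → ∀ c → ∃₂ (Split l c)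
    split {l} l∈ (inj₁ (refl , refl)) c =
      link u u v v c , link v u (tgt′ l) (tgt l) (colour l) , record
        { src-a = refl ; tgt-a = refl ; src-b = refl ; tgt-b = refl
        ; good-a = record { srcs = inj₁ refl ; tgts = inj₁ refl ; core = u∼v
                          ; src≢tgt = u≢v ; src≢tgt′ = u≢v ; src′≢tgt = u≢v }
        ; good-b = record { srcs = inj₂ (sym G u∼v) ; tgts = tgts ; core = core
                          ; src≢tgt  = λ { refl → v∉verts l∈ (there (there (there (here refl)))) }
                          ; src≢tgt′ = λ { refl → v∉verts l∈ (there (there (here refl))) }
                          ; src′≢tgt = src≢tgt }
        ; site-a = λ { (refl , _) → refl , refl }
        ; site-b = id
        ; site-v = inj₁ (refl , refl)
        ; u∈l = here refl
        ; roles = inj₁ ((refl , λ where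
              (here e) → inj₁ e
              (there (here e)) → inj₁ e
              (there (there (here e))) → inj₂ e
              (there (there (there (here e)))) → inj₂ e)
            , (refl , λ where
              (here e)  → inj₁ e
              (there p) → inj₂ (there p)))
        }
      where open Good (All.lookup good l∈)
    split {l} l∈ (inj₂ (refl , refl)) c =
      link (src l) (src′ l) u v (colour l) , link v v u u c , record
        { src-a = refl ; tgt-a = refl ; src-b = refl ; tgt-b = refl
        ; good-a = record { srcs = srcs ; tgts = inj₂ (sym G u∼v) ; core = core
                          ; src≢tgt  = λ { refl → v∉verts l∈ (here refl) }
                          ; src≢tgt′ = src≢tgt
                          ; src′≢tgt = λ { refl → v∉verts l∈ (there (here refl)) } }
        ; good-b = record { srcs = inj₁ refl ; tgts = inj₁ refl ; core = sym G u∼v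
                          ; src≢tgt = u≢v ∘ ≡-sym ; src≢tgt′ = u≢v ∘ ≡-sym ; src′≢tgt = u≢v ∘ ≡-sym }
        ; site-a = id
        ; site-b = λ { (refl , _) → refl , refl }
        ; site-v = inj₂ (refl , refl)
        ; u∈l = there (there (here refl))
        ; roles = inj₂ ((refl , λ where
              (here e) → inj₂ (here e)
              (there (here e)) → inj₂ (there (here e))
              (there (there (here e))) → inj₂ (there (there (here e)))
              (there (there (there (here e)))) → inj₁ e)
            , (refl , λ where
              (here e) → inj₂ e
              (there (here e)) → inj₂ e
              (there (there (here e))) → inj₁ e
              (there (there (there (here e)))) → inj₁ e))
        }
      where open Good (All.lookup good l∈)

    module Extended {l} (l∈ : l ∈ ls) {c} (c≤Δ : c ≤ maxDegree G) (c∉ : c ∉ used) {a b} (sp : Split l c a b) where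
      open Split sp

      ls′ : List (Link n)
      ls′ = splice a b l∈

      ls′⁻ : ∀ {k} → k ∈ ls′ → IsNew c k ⊎ Prolongs l k ⊎ k ∈ ls
      ls′⁻ p with splice-∈⁻ a b l∈ p | roles
      ... | inj₁ refl        | inj₁ (new , _) = inj₁ new
      ... | inj₁ refl        | inj₂ (pro , _) = inj₂ (inj₁ pro)
      ... | inj₂ (inj₁ refl) | inj₁ (_ , pro) = inj₂ (inj₁ pro)
      ... | inj₂ (inj₁ refl) | inj₂ (_ , new) = inj₁ new
      ... | inj₂ (inj₂ q)    | _              = inj₂ (inj₂ q)

      a∈ : a ∈ ls′
      a∈ = splice-∈ˡ a b l∈

      b∈ : b ∈ ls′
      b∈ = splice-∈ʳ a b l∈

      v∈′ : v ∈ trail r ls′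
      v∈′ = there (subst (_∈ map tgt ls′) tgt-a (∈-map⁺ tgt a∈))

      trail⁺ : ∀ {z} → z ∈ trail r ls → z ∈ trail r ls′
      trail⁺ (here e) = here e
      trail⁺ (there p) with k , k∈ , refl ← ∈-map⁻ tgt p | splice-∈⁺ a b l∈ k∈
      ... | inj₁ refl = there (subst (_∈ map tgt ls′) tgt-b (∈-map⁺ tgt b∈))
      ... | inj₂ k∈′  = there (∈-map⁺ tgt k∈′)

      tail⁻ : ∀ {z} → z ∈ map tgt ls′ → z ≡ v ⊎ z ∈ map tgt ls
      tail⁻ p with k , k∈ , refl ← ∈-map⁻ tgt p | splice-∈⁻ a b l∈ k∈
      ... | inj₁ refl        = inj₁ tgt-a
      ... | inj₂ (inj₁ refl) = inj₂ (subst (_∈ map tgt ls) (≡-sym tgt-b) (∈-map⁺ tgt l∈))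
      ... | inj₂ (inj₂ q)    = inj₂ (∈-map⁺ tgt q)

      trail⁻ : ∀ {z} → z ∈ trail r ls′ → z ≡ v ⊎ z ∈ trail r ls
      trail⁻ (here e)  = inj₂ (here e)
      trail⁻ (there p) = [ inj₁ , inj₂ ∘ there ]′ (tail⁻ p)

      -- Among the targets, `tgt l` gives way to `v` followed by `tgt l`, so the only new entry is
      -- `v`, which was not on the line.
      distinct′ : Unique (trail r ls′)
      distinct′ with r∉ ∷ uniq ← distinct =
        All.tabulate (λ p → [ (λ { refl refl → v∉ (here refl) }) , All.lookup r∉ ]′ (tail⁻ p)) ∷
        AllPairsₚ.map⁺ (splice-AllPairs a b l∈ (λ ne → ne ∘ ≡-sym) a≢b lift (AllPairsₚ.map⁻ uniq))
        where
        tgt≢v : ∀ {k} → k ∈ ls → tgt k ≢ v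
        tgt≢v k∈ refl = v∉ (there (∈-map⁺ tgt k∈))
        a≢b : tgt a ≢ tgt b
        a≢b = subst₂ _≢_ (≡-sym tgt-a) (≡-sym tgt-b) (tgt≢v l∈ ∘ ≡-sym)
        lift : ∀ {k} → k ∈ ls → tgt k ≢ tgt l → tgt k ≢ tgt a × tgt k ≢ tgt b
        lift {k} k∈ ne = subst (tgt k ≢_) (≡-sym tgt-a) (tgt≢v k∈) , subst (tgt k ≢_) (≡-sym tgt-b) ne

      site′ : ∀ {z} → z ∈ trail r ls′ → ∃ λ k → k ∈ ls′ × (SrcSite k z ⊎ TgtSite k z)
      site′ p with trail⁻ p
      ... | inj₁ refl = [ (λ s → a , a∈ , inj₂ s) , (λ s → b , b∈ , inj₁ s) ]′ site-v
      ... | inj₂ q with site q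
      ...   | k , k∈ , s with splice-∈⁺ a b l∈ k∈ | s
      ...     | inj₂ k∈′  | _      = k , k∈′ , s
      ...     | inj₁ refl | inj₁ t = a , a∈ , inj₁ (site-a t)
      ...     | inj₁ refl | inj₂ t = b , b∈ , inj₂ (site-b t)

      inside′ : ∀ {k z} → k ∈ ls′ → z ∈ verts k → z ∈ trail r ls′
      inside′ k∈ z∈ with ls′⁻ k∈
      ... | inj₁ (_ , ⊆uv) = [ (λ { refl → trail⁺ u∈ }) , (λ { refl → v∈′ }) ]′ (⊆uv z∈)
      ... | inj₂ (inj₁ (_ , ⊆l)) = [ (λ { refl → v∈′ }) , trail⁺ ∘ inside l∈ ]′ (⊆l z∈)
      ... | inj₂ (inj₂ k∈ls) = trail⁺ (inside k∈ls z∈)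

      colour-l∈used : colour l ∈ used
      colour-l∈used = Palette.covers (palette u∈) l∈ u∈l

      -- The new link can meet an old one only at `u`, where `c` is fresh. The prolonged link keeps
      -- its colour and gains only `v`, which lies on no old link. The two differ in colour because
      -- the colour of `l` is already used at `u`.
      proper′ : AllPairs (λ k m → ¬ Clash k m) ls′
      proper′ = splice-AllPairs a b l∈ (λ ¬clash → ¬clash ∘ flip-clash) a#b lift proper
        where
        flip-clash : ∀ {k m : Link n} → Clash k m → Clash m k
        flip-clash (e , z , p , q) = ≡-sym e , z , q , p
        a#b : ¬ Clash a b
        a#b (e , _) with roles
        ... | inj₁ ((refl , _) , (e′ , _)) = c∉ (subst (_∈ used) (≡-sym (trans e e′)) colour-l∈used)
        ... | inj₂ ((e′ , _) , (refl , _)) = c∉ (subst (_∈ used) (trans (≡-sym e′) e) colour-l∈used)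
        new# : ∀ {k m} → k ∈ ls → IsNew c m → ¬ Clash k m
        new# k∈ (refl , ⊆uv) (e , z , z∈k , z∈m) with ⊆uv z∈m
        ... | inj₁ refl = c∉ (subst (_∈ used) e (Palette.covers (palette u∈) k∈ z∈k))
        ... | inj₂ refl = v∉verts k∈ z∈k
        prolonged# : ∀ {k m} → k ∈ ls → ¬ Clash k l → Prolongs l m → ¬ Clash k m
        prolonged# k∈ ¬clash (e′ , ⊆l) (e , z , z∈k , z∈m) with ⊆l z∈m
        ... | inj₁ refl = v∉verts k∈ z∈k
        ... | inj₂ z∈l  = ¬clash (trans e e′ , z , z∈k , z∈l)
        lift : ∀ {k} → k ∈ ls → ¬ Clash k l → ¬ Clash k a × ¬ Clash k b
        lift k∈ ¬clash with roles
        ... | inj₁ (new , pro) = new# k∈ new , prolonged# k∈ ¬clash pro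
        ... | inj₂ (pro , new) = prolonged# k∈ ¬clash pro , new# k∈ new

      bounded′ : All (λ k → colour k ≤ maxDegree G) ls′
      bounded′ = All.tabulate λ p → [ (λ { (refl , _) → c≤Δ }) ,
        [ (λ { (e , _) → subst (_≤ maxDegree G) (≡-sym e) (All.lookup bounded l∈) }) , All.lookup bounded ]′ ]′ (ls′⁻ p)

      -- Only the two replacing links pass through `v`: two colours, balanced by the one neighbour
      -- `u`.
      palette-v : Palette r ls′ v
      palette-v = record
        { colours = c ∷ colour l ∷ [] ; nbrs = [ u ] ; covers = cov
        ; nbrs-unique = [] ∷ [] ; nbrs-adj = sym G u∼v ∷ []
        ; nbrs-trail = λ { (here refl) → trail⁺ u∈ } ; few = ≤-refl }
        where
        cov : ∀ {k} → k ∈ ls′ → v ∈ verts k → colour k ∈ c ∷ colour l ∷ []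
        cov k∈ v∈k with ls′⁻ k∈
        ... | inj₁ (e , _)        = here e
        ... | inj₂ (inj₁ (e , _)) = there (here e)
        ... | inj₂ (inj₂ k∈ls)    = contradiction v∈k (v∉verts k∈ls)

      palette-u : Palette r ls′ u
      palette-u = record
        { colours = c ∷ used ; nbrs = v ∷ nbrs ; covers = cov
        ; nbrs-unique = All.tabulate (λ p → λ { refl → v∉ (nbrs-trail p) }) ∷ nbrs-unique
        ; nbrs-adj = u∼v ∷ nbrs-adj
        ; nbrs-trail = λ { (here refl) → v∈′ ; (there p) → trail⁺ (nbrs-trail p) }
        ; few = s≤s few }
        where
        open Palette (palette u∈)
        cov : ∀ {k} → k ∈ ls′ → u ∈ verts k → colour k ∈ c ∷ used
        cov k∈ u∈k with ls′⁻ k∈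
        ... | inj₁ (e , _)        = here e
        ... | inj₂ (inj₁ (e , _)) = there (subst (_∈ used) (≡-sym e) colour-l∈used)
        ... | inj₂ (inj₂ k∈ls)    = there (covers k∈ls u∈k)

      -- Away from `u` and `v` only the prolonged link can be a changed link through `z`, and it has
      -- the colour of `l`.
      palette-other : ∀ {z} → z ∈ trail r ls → z ≢ u → Palette r ls′ z
      palette-other {z} z∈ z≢u = record
        { colours = colours ; nbrs = nbrs ; covers = cov ; nbrs-unique = nbrs-unique
        ; nbrs-adj = nbrs-adj ; nbrs-trail = trail⁺ ∘ nbrs-trail ; few = few }
        where
        open Palette (palette z∈)
        z≢v : z ≢ v
        z≢v refl = v∉ z∈
        cov : ∀ {k} → k ∈ ls′ → z ∈ verts k → colour k ∈ colours
        cov k∈ z∈k with ls′⁻ k∈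
        ... | inj₁ (_ , ⊆uv)       = ⊥-elim ([ z≢u , z≢v ]′ (⊆uv z∈k))
        ... | inj₂ (inj₁ (e , ⊆l)) = [ (λ z≡v → contradiction z≡v z≢v) , (λ z∈l → subst (_∈ colours) (≡-sym e) (covers l∈ z∈l)) ]′ (⊆l z∈k)
        ... | inj₂ (inj₂ k∈ls)     = covers k∈ls z∈k

      palette′ : ∀ {z} → z ∈ trail r ls′ → Palette r ls′ z
      palette′ {z} p with trail⁻ p | z Fin.≟ u
      ... | inj₁ refl | _        = palette-v
      ... | inj₂ _    | yes refl = palette-u
      ... | inj₂ q    | no z≢u   = palette-other q z≢u

      layout′ : Layout r ls′
      layout′ = record
        { chain = splice-Chain l∈ src-a (trans tgt-a (≡-sym src-b)) tgt-b chain
        ; good = splice-All a b l∈ good-a good-b good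
        ; inside = inside′ ; distinct = distinct′ ; site = site′
        ; proper = proper′ ; bounded = bounded′ ; palette = palette′ }

    insert : ∃ λ ls′ → Layout r ls′ × v ∈ trail r ls′ × (∀ {z} → z ∈ trail r ls → z ∈ trail r ls′)
    insert =
      let l , l∈ , s    = site u∈
          c , c≤Δ , c∉  = fresh-below (maxDegree G) used room
          a , b , sp    = split l∈ s c
          open Extended l∈ c≤Δ c∉ sp
      in ls′ , layout′ , v∈′ , trail⁺
      where
      -- `v` is a neighbour of `u` not listed in `nbrs`, whose entries are on the line. So
      -- `v ∷ nbrs` consists of distinct neighbours, and its length bounds that of `used`.
      room : length used ≤ maxDegree G
      room = ≤-trans few (neighbours≤maxDegree
        (All.tabulate (λ p → λ { refl → v∉ (nbrs-trail p) }) ∷ nbrs-unique) (u∼v ∷ nbrs-adj))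
        where open Palette (palette u∈)

  -- Growing the line until it contains every vertex

  reach : ∀ {r ls u v} → Layout r ls → u ∈ trail r ls → Star (Adj G) u v →
    ∃ λ ls′ → Layout r ls′ × v ∈ trail r ls′ × (∀ {z} → z ∈ trail r ls → z ∈ trail r ls′)
  reach S u∈ ε = _ , S , u∈ , id
  reach {r} {ls} S u∈ (_◅_ {j = w} u∼w path) with w ∈? trail r ls
  ... | yes w∈ = reach S w∈ path
  ... | no w∉ =
    let _ , S′ , w∈ , ⊆′  = Insert.insert S u∈ u∼w w∉
        _ , S″ , v∈ , ⊆″ = reach S′ w∈ path
    in _ , S″ , v∈ , ⊆″ ∘ ⊆′

  spanning : ∀ {r ls} → Connected G → Layout r ls → ∃ λ ls′ → Layout r ls′ × (∀ v → v ∈ trail r ls′)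
  spanning {r} conn S₀ = let ls , S , all∈ , _ = go S₀ (allFin n) in ls , S , λ v → All.lookup all∈ (∈-allFin v)
    where
    go : ∀ {ls} → Layout r ls → (vs : List (Fin n)) →
      ∃ λ ls′ → Layout r ls′ × All (_∈ trail r ls′) vs × (∀ {z} → z ∈ trail r ls → z ∈ trail r ls′)
    go S [] = _ , S , [] , id
    go S (v ∷ vs) =
      let _ , S′ , v∈ , ⊆′  = reach S (here refl) (conn r v)
          _ , S″ , vs∈ , ⊆″ = go S′ vs
      in _ , S″ , ⊆″ v∈ ∷ vs∈ , ⊆″ ∘ ⊆′

  -- Exchanging the ends of a single link

  module Local {l} (good : Good l) where
    open Good good

    outer-src : outer l (src l) ≡ src′ l
    outer-src = trans (cong (transpose _ _) (transpose-other src≢tgt′ src≢tgt)) (transpose-fst (src l) (src′ l))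

    outer-src′ : outer l (src′ l) ≡ src l
    outer-src′ = trans (cong (transpose _ _) (transpose-other src′≢tgt′ src′≢tgt)) (transpose-snd (src l) (src′ l))

    outer-tgt′ : outer l (tgt′ l) ≡ tgt l
    outer-tgt′ = trans (cong (transpose _ _) (transpose-fst (tgt′ l) (tgt l))) (transpose-other (src≢tgt ∘ ≡-sym) (src′≢tgt ∘ ≡-sym))

    outer-tgt : outer l (tgt l) ≡ tgt′ l
    outer-tgt = trans (cong (transpose _ _) (transpose-snd (tgt′ l) (tgt l))) (transpose-other (src≢tgt′ ∘ ≡-sym) (src′≢tgt′ ∘ ≡-sym))

    inner-src′ : inner l (src′ l) ≡ tgt′ l
    inner-src′ = transpose-fst (src′ l) (tgt′ l)

    inner-tgt′ : inner l (tgt′ l) ≡ src′ l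
    inner-tgt′ = transpose-snd (src′ l) (tgt′ l)

    outer-closed : ∀ {v} → v ∈ verts l → outer l v ∈ verts l
    outer-closed (here refl)                         = there (here outer-src)
    outer-closed (there (here refl))                 = here outer-src′
    outer-closed (there (there (here refl)))         = there (there (there (here outer-tgt′)))
    outer-closed (there (there (there (here refl)))) = there (there (here outer-tgt))

    inner-other : ∀ {v} → v ≢ src′ l → v ≢ tgt′ l → inner l v ≡ v
    inner-other = transpose-other

    inner-view : ∀ v → v ≡ src′ l ⊎ v ≡ tgt′ l ⊎ inner l v ≡ v
    inner-view v with v Fin.≟ src′ l
    ... | yes e = inj₁ e
    ... | no _ with v Fin.≟ tgt′ l
    ...   | yes e = inj₂ (inj₁ e)
    ...   | no _  = inj₂ (inj₂ refl)

    inner-closed : ∀ {v} → v ∈ verts l → inner l v ∈ verts l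
    inner-closed {v} v∈ with inner-view v
    ... | inj₁ refl        = there (there (here inner-src′))
    ... | inj₂ (inj₁ refl) = there (here inner-tgt′)
    ... | inj₂ (inj₂ fix)  = subst (_∈ verts l) (≡-sym fix) v∈

    outer-involutive : ∀ {v} → v ∈ verts l → outer l (outer l v) ≡ v
    outer-involutive (here refl)                         = trans (cong (outer l) outer-src) outer-src′
    outer-involutive (there (here refl))                 = trans (cong (outer l) outer-src′) outer-src
    outer-involutive (there (there (here refl)))         = trans (cong (outer l) outer-tgt′) outer-tgt
    outer-involutive (there (there (there (here refl)))) = trans (cong (outer l) outer-tgt) outer-tgt′

    inner-involutive : ∀ {v} → inner l (inner l v) ≡ v
    inner-involutive {v} with inner-view v
    ... | inj₁ refl        = trans (cong (inner l) inner-src′) inner-tgt′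
    ... | inj₂ (inj₁ refl) = trans (cong (inner l) inner-tgt′) inner-src′
    ... | inj₂ (inj₂ fix)  = trans (cong (inner l) fix) fix

    outer-onEdge : ∀ {v} → v ∈ verts l → outer l v ≡ v ⊎ Adj G v (outer l v)
    outer-onEdge (here refl) rewrite outer-src = [ inj₁ ∘ ≡-sym , inj₂ ]′ srcs
    outer-onEdge (there (here refl)) rewrite outer-src′ = [ inj₁ , inj₂ ∘ sym G ]′ srcs
    outer-onEdge (there (there (here refl))) rewrite outer-tgt′ = [ inj₁ , inj₂ ∘ sym G ]′ tgts
    outer-onEdge (there (there (there (here refl)))) rewrite outer-tgt = [ inj₁ ∘ ≡-sym , inj₂ ]′ tgts

    inner-onEdge : ∀ {v} → inner l v ≡ v ⊎ Adj G v (inner l v)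
    inner-onEdge {v} with inner-view v
    ... | inj₁ refl        = inj₂ (subst (Adj G _) (≡-sym inner-src′) core)
    ... | inj₂ (inj₁ refl) = inj₂ (subst (Adj G _) (≡-sym inner-tgt′) (sym G core))
    ... | inj₂ (inj₂ fix)  = inj₁ fix

    swap : Fin n → Fin n
    swap v = outer l (inner l (outer l v))

    swap-src : swap (src l) ≡ tgt l
    swap-src = trans (cong (outer l) (trans (cong (inner l) outer-src) inner-src′)) outer-tgt′

    swap-tgt : swap (tgt l) ≡ src l
    swap-tgt = trans (cong (outer l) (trans (cong (inner l) outer-tgt) inner-tgt′)) outer-src′

    -- The first `outer` parks an agent from the interior of the path on an end, out of reach of
    -- `inner`, and the second brings it back.
    swap-other : ∀ {v} → v ∈ verts l → v ≢ src l → v ≢ tgt l → swap v ≡ v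
    swap-other (here refl) v≢src _ = contradiction refl v≢src
    swap-other (there (here refl)) v≢src _ = trans (cong (outer l)
      (trans (cong (inner l) outer-src′) (inner-other (v≢src ∘ ≡-sym) src≢tgt′))) outer-src
    swap-other (there (there (here refl))) _ v≢tgt = trans (cong (outer l)
      (trans (cong (inner l) outer-tgt′) (inner-other (src′≢tgt ∘ ≡-sym) (v≢tgt ∘ ≡-sym)))) outer-tgt
    swap-other (there (there (there (here refl)))) _ v≢tgt = contradiction refl v≢tgt

  -- Placements under a sequence of matchings

  run : (Fin n → Fin n) → List (Matching G) → Fin n → Fin n
  run p []       = p
  run p (M ∷ Ms) = run (p ∘ σ M) Ms

  run-++ : ∀ p Ms {Ns} → run p (Ms ++ Ns) ≡ run (run p Ms) Ns
  run-++ p []       = refl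
  run-++ p (M ∷ Ms) = run-++ (p ∘ σ M) Ms

  module _ {P : (Fin n → Fin n) → Set} where

    placements-++ˡ : ∀ {p} Ms {Ns} → Any P (placements {G = G} p Ms) → Any P (placements {G = G} p (Ms ++ Ns))
    placements-++ˡ [] {[]}    (here Pp) = here Pp
    placements-++ˡ [] {_ ∷ _} (here Pp) = here Pp
    placements-++ˡ (M ∷ Ms) (here Pp)   = here Pp
    placements-++ˡ (M ∷ Ms) (there q)   = there (placements-++ˡ Ms q)

    placements-++ʳ : ∀ {p} Ms {Ns} → Any P (placements {G = G} (run p Ms) Ns) → Any P (placements {G = G} p (Ms ++ Ns))
    placements-++ʳ []       q = q
    placements-++ʳ (M ∷ Ms) q = there (placements-++ʳ Ms q)

  -- Positions on the line, and the links of one parity and colour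

  module Simulate {r ls} (S : Layout r ls) where
    open Layout S

    -- Positions run from 0 to `m` inclusive, and link `i` joins positions `i` and `suc i`.
    m : ℕ
    m = length ls

    lnk : ℕ → Link n
    lnk = nth (link r r r r 0) ls

    vert : ℕ → Fin n
    vert = nth r (trail r ls)

    lnk∈ : ∀ {i} → i < m → lnk i ∈ ls
    lnk∈ = nth-∈

    src-lnk : ∀ {i} → i < m → src (lnk i) ≡ vert i
    src-lnk = Chain-src {ls = ls} chain

    tgt-lnk : ∀ {i} → i < m → tgt (lnk i) ≡ vert (suc i)
    tgt-lnk = nth-tgt {ls = ls}

    vert-injective : ∀ {i j} → i ≤ m → j ≤ m → vert i ≡ vert j → i ≡ j
    vert-injective i≤ j≤ = nth-injective distinct (bound i≤) (bound j≤)
      where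
      bound : ∀ {i} → i ≤ m → i < length (trail r ls)
      bound {i} i≤ = s≤s (subst (i ≤_) (≡-sym (length-map tgt ls)) i≤)

    -- Different links do not clash by `proper`; equal links have equal targets, and each target
    -- occupies only one position.
    lnk-unclash : ∀ {i j} → i < m → j < m → Clash (lnk i) (lnk j) → i ≡ j
    lnk-unclash {i} {j} i< j< (e , z , z∈i , z∈j) with ∈-AllPairs₂ proper (lnk∈ i<) (lnk∈ j<)
    ... | inj₁ eq = suc-injective (vert-injective i< j< (trans (≡-sym (tgt-lnk i<)) (trans (cong tgt eq) (tgt-lnk j<))))
    ... | inj₂ (inj₁ ¬clash) = contradiction (e , z , z∈i , z∈j) ¬clash
    ... | inj₂ (inj₂ ¬clash) = contradiction (≡-sym e , z , z∈j , z∈i) ¬clash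

    good-lnk : ∀ {i} → i < m → Good (lnk i)
    good-lnk i< = All.lookup good (lnk∈ i<)

    module Class (b : Bool) (c : ℕ) where

      Active : ℕ → Set
      Active i = parity i ≡ b × colour (lnk i) ≡ c

      find : ∀ v → Dec (∃ λ i → i < m × Active i × v ∈ verts (lnk i))
      find v = anyUpTo? (λ i → ((parity i Bool.≟ b) ×-dec (colour (lnk i) ≟ c)) ×-dec (v ∈? verts (lnk i))) m

      -- The union of the local maps of the active links. These share a colour, so at most one of
      -- them contains `v` and the choice made by `find` is forced.
      piecewise : (Link n → Fin n → Fin n) → Fin n → Fin n
      piecewise f v with find v
      ... | yes (i , _) = f (lnk i) v
      ... | no _        = v

      module _ (f : Link n → Fin n → Fin n) where

        piecewise-on : ∀ {i v} → i < m → Active i → v ∈ verts (lnk i) → piecewise f v ≡ f (lnk i) v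
        piecewise-on {i} {v} i< (pi , ci) v∈ with find v
        ... | yes (j , j< , (_ , cj) , v∈j) =
          cong (λ k → f (lnk k) v) (lnk-unclash j< i< (trans cj (≡-sym ci) , v , v∈j , v∈))
        ... | no none = contradiction (i , i< , (pi , ci) , v∈) none

        piecewise-off : ∀ {v} → (∀ {i} → i < m → Active i → v ∉ verts (lnk i)) → piecewise f v ≡ v
        piecewise-off {v} none with find v
        ... | yes (i , i< , act , v∈) = contradiction v∈ (none i< act)
        ... | no _ = refl

        matching : (∀ {l v} → Good l → v ∈ verts l → f l v ∈ verts l) →
                   (∀ {l v} → Good l → v ∈ verts l → f l (f l v) ≡ v) →
                   (∀ {l v} → Good l → v ∈ verts l → f l v ≡ v ⊎ Adj G v (f l v)) → Matching G
        matching closed involutive edge = record { σ = piecewise f ; invol = inv ; onEdge = onE }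
          where
          inv : ∀ v → piecewise f (piecewise f v) ≡ v
          inv v with find v
          ... | yes (i , i< , act , v∈) =
            trans (piecewise-on i< act (closed (good-lnk i<) v∈)) (involutive (good-lnk i<) v∈)
          ... | no none = piecewise-off λ i< act v∈ → none (_ , i< , act , v∈)
          onE : ∀ v → piecewise f v ≡ v ⊎ Adj G v (piecewise f v)
          onE v with find v
          ... | yes (i , i< , act , v∈) = edge (good-lnk i<) v∈
          ... | no _ = inj₁ refl

      outerM innerM : Matching G
      outerM = matching outer (λ g → Local.outer-closed g) (λ g → Local.outer-involutive g) (λ g → Local.outer-onEdge g)
      innerM = matching inner (λ g → Local.inner-closed g) (λ g _ → Local.inner-involutive g) (λ g _ → Local.inner-onEdge g)

      abstract

        class : List (Matching G)
        class = outerM ∷ innerM ∷ outerM ∷ []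

        turn : Fin n → Fin n
        turn v = σ outerM (σ innerM (σ outerM v))

        turn-on : ∀ {i v} (i< : i < m) → Active i → v ∈ verts (lnk i) → turn v ≡ Local.swap (good-lnk i<) v
        turn-on {i} {v} i< act v∈ = begin
          turn v                                        ≡⟨ cong (σ outerM ∘ σ innerM) (piecewise-on outer i< act v∈) ⟩
          σ outerM (σ innerM (outer l v))               ≡⟨ cong (σ outerM) (piecewise-on inner i< act v∈₁) ⟩
          σ outerM (inner l (outer l v))                ≡⟨ piecewise-on outer i< act (inner-closed v∈₁) ⟩
          swap v                                        ∎
          where
          open ≡-Reasoning
          open Local (good-lnk i<)
          l : Link n
          l = lnk i
          v∈₁ : outer l v ∈ verts l
          v∈₁ = outer-closed v∈

        turn-src : ∀ {i} → i < m → Active i → turn (vert i) ≡ vert (suc i)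
        turn-src {i} i< act = begin
          turn (vert i)      ≡⟨ cong turn (src-lnk i<) ⟨
          turn (src (lnk i)) ≡⟨ turn-on i< act (here refl) ⟩
          swap (src (lnk i)) ≡⟨ swap-src ⟩
          tgt (lnk i)        ≡⟨ tgt-lnk i< ⟩
          vert (suc i)       ∎
          where
          open ≡-Reasoning
          open Local (good-lnk i<)

        turn-tgt : ∀ {i} → i < m → Active i → turn (vert (suc i)) ≡ vert i
        turn-tgt {i} i< act = begin
          turn (vert (suc i)) ≡⟨ cong turn (tgt-lnk i<) ⟨
          turn (tgt (lnk i))  ≡⟨ turn-on i< act (there (there (there (here refl)))) ⟩
          swap (tgt (lnk i))  ≡⟨ swap-tgt ⟩
          src (lnk i)         ≡⟨ src-lnk i< ⟩
          vert i              ∎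
          where
          open ≡-Reasoning
          open Local (good-lnk i<)

        -- The vertex may still be interior to the path of an active link; then `swap-other`
        -- restores its agent. Otherwise none of the three matchings touches it.
        turn-fix : ∀ {s} → s ≤ m → (∀ {i} → i < m → Active i → s ≢ i × s ≢ suc i) → turn (vert s) ≡ vert s
        turn-fix {s} s≤ off = go (find (vert s))
          where
          go : Dec (∃ λ i → i < m × Active i × vert s ∈ verts (lnk i)) → turn (vert s) ≡ vert s
          go (yes (i , i< , act , v∈)) = trans (turn-on i< act v∈) (Local.swap-other (good-lnk i<) v∈
            (λ e → proj₁ (off i< act) (vert-injective s≤ (<⇒≤ i<) (trans e (src-lnk i<))))
            (λ e → proj₂ (off i< act) (vert-injective s≤ i< (trans e (tgt-lnk i<)))))
          go (no none) = trans (cong (σ outerM ∘ σ innerM) (off′ outer)) (trans (cong (σ outerM) (off′ inner)) (off′ outer))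
            where
            off′ : ∀ f → piecewise f (vert s) ≡ vert s
            off′ f = piecewise-off f λ i< act v∈ → none (_ , i< , act , v∈)

        -- The meeting occurs after the first matching: the two agents then stand on `src′` and
        -- `tgt′`, the ends of the middle edge.
        meet-class : ∀ {p i} → i < m → Active i → Any (λ q → AcquaintedIn G q (p (vert i)) (p (vert (suc i)))) (placements p class)
        meet-class {p} {i} i< act = there (here (src′ l , tgt′ l , Good.core (good-lnk i<) ,
          cong p (trans (piecewise-on outer i< act (there (here refl))) (trans outer-src′ (src-lnk i<))) ,
          cong p (trans (piecewise-on outer i< act (there (there (here refl)))) (trans outer-tgt′ (tgt-lnk i<)))))
          where
          l : Link n
          l = lnk i
          open Local (good-lnk i<)

        run-class : ∀ p v → run p class v ≡ p (turn v)
        run-class p v = refl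

        length-class : length class ≡ 3
        length-class = refl

    open Class using (class; run-class; length-class; turn; turn-src; turn-tgt; turn-fix; meet-class)

    -- One round: all colours in turn for one parity

    sweep : Bool → ℕ → List (Matching G)
    sweep b zero    = []
    sweep b (suc k) = sweep b k ++ class b k

    -- Matchings compose with a placement on the right, so the colour treated last acts first on the
    -- vertex.
    perm : Bool → ℕ → Fin n → Fin n
    perm b zero    v = v
    perm b (suc k) v = perm b k (turn b k v)

    run-sweep : ∀ p b k v → run p (sweep b k) v ≡ p (perm b k v)
    run-sweep p b zero    v = refl
    run-sweep p b (suc k) v = begin
      run p (sweep b k ++ class b k) v       ≡⟨ cong (λ q → q v) (run-++ p (sweep b k) {class b k}) ⟩
      run (run p (sweep b k)) (class b k) v  ≡⟨ run-class b k (run p (sweep b k)) v ⟩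
      run p (sweep b k) (turn b k v)         ≡⟨ run-sweep p b k (turn b k v) ⟩
      p (perm b (suc k) v)                   ∎
      where open ≡-Reasoning

    ≡not⇒≢ : ∀ {x b} → x ≡ not b → x ≢ b
    ≡not⇒≢ e e′ = Bool.not-¬ e′ e

    -- Links of equal parity are never consecutive on the line, so two different ones share no end.
    off-others : ∀ {b c i j} → parity i ≡ b → colour (lnk i) ≢ c → Class.Active b c j → (i ≢ j × i ≢ suc j) × (suc i ≢ j × suc i ≢ suc j)
    off-others {i = i} {j} pi ci≢c (pj , cj) = (i≢j , (λ { refl → ≡not⇒≢ (cong not pj) pi })) ,
                                   ((λ { refl → ≡not⇒≢ (cong not pi) pj }) , i≢j ∘ suc-injective)
      where
      i≢j : i ≢ j
      i≢j refl = ci≢c cj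

    module _ {b i} (i< : i < m) (pi : parity i ≡ b) where

      -- Classes of other colours may route paths through the ends of link `i`, but by `off-others`
      -- and `turn-fix` they leave the agents there in place.
      perm-before : ∀ {k} → k ≤ colour (lnk i) → perm b k (vert i) ≡ vert i × perm b k (vert (suc i)) ≡ vert (suc i)
      perm-before {zero} _ = refl , refl
      perm-before {suc k} k<c =
        let e , e′ = perm-before {k} (<⇒≤ k<c) in
        trans (cong (perm b k) (turn-fix b k (<⇒≤ i<) λ _ act → proj₁ (off-others pi (<⇒≢ k<c ∘ ≡-sym) act))) e ,
        trans (cong (perm b k) (turn-fix b k i< λ _ act → proj₂ (off-others pi (<⇒≢ k<c ∘ ≡-sym) act))) e′

      perm-after : ∀ {k} → colour (lnk i) < k → perm b k (vert i) ≡ vert (suc i) × perm b k (vert (suc i)) ≡ vert i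
      perm-after {suc k} (s≤s c≤k) with m≤n⇒m<n∨m≡n c≤k
      ... | inj₂ refl =
        let e , e′ = perm-before ≤-refl in
        trans (cong (perm b k) (turn-src b k i< (pi , refl))) e′ ,
        trans (cong (perm b k) (turn-tgt b k i< (pi , refl))) e
      ... | inj₁ c<k =
        let e , e′ = perm-after c<k in
        trans (cong (perm b k) (turn-fix b k (<⇒≤ i<) λ _ act → proj₁ (off-others pi (<⇒≢ c<k) act))) e ,
        trans (cong (perm b k) (turn-fix b k i< λ _ act → proj₂ (off-others pi (<⇒≢ c<k) act))) e′

      -- When the colour of link `i` comes up, its ends still carry the agents that stood there at
      -- the start of the round.
      meet-sweep : ∀ {p k} → colour (lnk i) < k →
        Any (λ q → AcquaintedIn G q (p (vert i)) (p (vert (suc i)))) (placements p (sweep b k))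
      meet-sweep {p} {suc k} (s≤s c≤k) with m≤n⇒m<n∨m≡n c≤k
      ... | inj₁ c<k  = placements-++ˡ (sweep b k) {class b k} (meet-sweep {p} c<k)
      ... | inj₂ refl =
        let e , e′ = perm-before ≤-refl in
        placements-++ʳ (sweep b k) {class b k} (subst₂ (λ x y → Any (λ q → AcquaintedIn G q x y) (placements (run p (sweep b k)) (class b k)))
          (trans (run-sweep p b k (vert i)) (cong p e)) (trans (run-sweep p b k (vert (suc i))) (cong p e′))
          (meet-class b k {run p (sweep b k)} i< (pi , refl)))

    perm-idle : ∀ {b s} → s ≤ m → (∀ {i} → i < m → parity i ≡ b → s ≢ i × s ≢ suc i) → ∀ k → perm b k (vert s) ≡ vert s
    perm-idle s≤ off zero    = refl
    perm-idle {b} s≤ off (suc k) =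
      trans (cong (perm b k) (turn-fix b k s≤ λ i< (pi , _) → off i< pi)) (perm-idle s≤ off k)

    -- Odd-even transposition on the line

    K : ℕ
    K = suc (maxDegree G)

    round : Bool → List (Matching G)
    round b = sweep b K

    colour< : ∀ {i} → i < m → colour (lnk i) < K
    colour< i< = s≤s (All.lookup bounded (lnk∈ i<))

    -- The motion of one agent in a round that exchanges every link of parity `b`. The truncation of
    -- `pred` at 0 covers the agent idling at the first position. Since the parity alternates, an
    -- agent keeps its direction until it idles at an end for one round, then turns.
    data Step (b : Bool) (s : ℕ) : ℕ → Set where
      up   : parity s ≡ b → s < m → Step b s (suc s)
      top  : parity s ≡ b → s ≡ m → Step b s s
      down : parity s ≡ not b → Step b s (pred s)

    step : ∀ b {s} → s ≤ m → ∃ (Step b s)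
    step b {s} s≤ with parity s Bool.≟ b | m≤n⇒m<n∨m≡n s≤
    ... | yes e | inj₁ s< = suc s , up e s<
    ... | yes e | inj₂ s≡ = s , top e s≡
    ... | no ne | _       = _ , down (Bool.¬-not ne)

    step-≤ : ∀ {b s s₁} → s ≤ m → Step b s s₁ → s₁ ≤ m
    step-≤ s≤ (up _ s<) = s<
    step-≤ s≤ (top _ _) = s≤
    step-≤ s≤ (down _)  = ≤-trans pred[n]≤n s≤

    step-run : ∀ {b s s₁} p → s ≤ m → Step b s s₁ → run p (round b) (vert s₁) ≡ p (vert s)
    step-run {b} {s} {s₁} p s≤ st = trans (run-sweep p b K (vert s₁)) (cong p (moved s≤ st))
      where
      moved : ∀ {s s₁} → s ≤ m → Step b s s₁ → perm b K (vert s₁) ≡ vert s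
      moved _  (up e s<)   = proj₂ (perm-after s< e (colour< s<))
      moved s≤ (top e refl) = perm-idle s≤
        (λ { i< pi → (λ { refl → <-irrefl refl i< }) , (λ { m≡ → ≡not⇒≢ (trans (cong parity m≡) (cong not pi)) e }) }) K
      moved {zero}  s≤ (down e) = perm-idle s≤ (λ _ pi → (λ { refl → ≡not⇒≢ e pi }) , λ ()) K
      moved {suc i} i< (down e) = proj₁ (perm-after i< (Bool.not-injective e) (colour< i<))

    -- Moves have length at most one. Agents approaching each other have positions of opposite
    -- parity, hence at odd distance; distance one is the exchange excluded by the last hypothesis,
    -- and from distance three on they cannot collide.
    step-mono : ∀ {b s s′ s₁ s₁′} → s < s′ → s′ ≤ m → Step b s s₁ → Step b s′ s₁′ → (s′ ≡ suc s → parity s ≢ b) → s₁ < s₁′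
    step-mono s<s′ _ (up _ _) (up _ _) _ = s≤s s<s′
    step-mono s<s′ _ (up e _) (top _ _) apart = ≤∧≢⇒< s<s′ (λ eq → apart (≡-sym eq) e)
    step-mono {s = s} {suc s′} s<s′ _ (up e _) (down e′) apart =
      ≤∧≢⇒< (s≤s⁻¹ (≤∧≢⇒< s<s′ (λ eq → apart (≡-sym eq) e))) (λ { refl → ≡not⇒≢ e′ (trans (Bool.not-involutive _) e) })
    step-mono s<s′ s′≤ (top _ refl) _ _ = contradiction s<s′ (≤⇒≯ s′≤)
    step-mono s<s′ _ (down _) (up _ _)  _ = s≤s (≤-trans pred[n]≤n (<⇒≤ s<s′))
    step-mono s<s′ _ (down _) (top _ _) _ = ≤-<-trans pred[n]≤n s<s′
    -- `pred` would merge positions 0 and 1, but these cannot both have parity `not b`.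
    step-mono {s = zero} {suc zero} _ _ (down e) (down e′) _ = contradiction (trans e (≡-sym e′)) λ ()
    step-mono {s = zero} {suc (suc _)} _ _ (down _) (down _) _ = s≤s z≤n
    step-mono {s = suc _} {suc _} (s≤s s<s′) _ (down _) (down _) _ = s<s′

    rounds : ℕ → Bool → List (Matching G)
    rounds zero    b = []
    rounds (suc t) b = round b ++ rounds t (not b)

    Meet : (Fin n → Fin n) → List (Matching G) → ℕ → ℕ → Set
    Meet p Ms s s′ = Any (λ q → AcquaintedIn G q (p (vert s)) (p (vert s′))) (placements p Ms)

    meet-later : ∀ {b t p s s′ s₁ s₁′} → s ≤ m → s′ ≤ m → Step b s s₁ → Step b s′ s₁′ →
      Meet (run p (round b)) (rounds t (not b)) s₁ s₁′ → Meet p (rounds (suc t) b) s s′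
    meet-later {b} {t} {p} s≤ s′≤ st st′ meet = placements-++ʳ (round b) {rounds t (not b)}
      (subst₂ (λ x y → Any (λ q → AcquaintedIn G q x y) (placements (run p (round b)) (rounds t (not b))))
        (step-run p s≤ st) (step-run p s′≤ st′) meet)

    -- Induction on the distance `d` of the lower agent from the last position. Until the two meet,
    -- it climbs one step per round and stays below the other, which is impossible once it is at
    -- `m`.
    meet-rising : ∀ {b t p s s′} d → s + d ≡ m → d ≤ t → parity s ≡ b → s < s′ → s′ ≤ m → Meet p (rounds t b) s s′
    meet-rising {s = s} zero s≡m _ _ s<s′ s′≤ =
      contradiction s′≤ (<⇒≱ (subst (_< _) (trans (≡-sym (+-identityʳ s)) s≡m) s<s′))
    meet-rising {b} {suc t} {p} {s} {s′} (suc d) s+d≡m (s≤s d≤t) e s<s′ s′≤ with s′ ≟ suc s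
    ... | yes refl = placements-++ˡ (round b) {rounds t (not b)} (meet-sweep {b} s′≤ e {p} (colour< s′≤))
    ... | no s′≢ =
      let st = up e (<-≤-trans s<s′ s′≤)
          s₁′ , st′ = step b s′≤
      in meet-later {t = t} (<⇒≤ (<-≤-trans s<s′ s′≤)) s′≤ st st′
           (meet-rising d (trans (≡-sym (+-suc s d)) s+d≡m) d≤t (cong not e)
             (step-mono s<s′ s′≤ st st′ (λ eq → contradiction eq s′≢)) (step-≤ s′≤ st′))

    -- The lower agent takes `s` rounds to come down, one idle round at position 0, and at most `m`
    -- rounds of rising; the idle round makes the inequality strict.
    meet-falling : ∀ {b t p s s′} → s + m < t → parity s ≡ not b → s < s′ → s′ ≤ m → Meet p (rounds t b) s s′
    meet-falling {b} {suc t} {p} {s} {s′} (s≤s s+m≤t) e s<s′ s′≤ =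
      let s₁′ , st′ = step b s′≤
      in meet-later {t = t} (<⇒≤ (<-≤-trans s<s′ s′≤)) s′≤ (down e) st′
           (rest s+m≤t e (step-mono s<s′ s′≤ (down e) st′ (λ _ → ≡not⇒≢ e)) (step-≤ s′≤ st′))
      where
      rest : ∀ {s p s₁′} → s + m ≤ t → parity s ≡ not b → pred s < s₁′ → s₁′ ≤ m → Meet p (rounds t (not b)) (pred s) s₁′
      rest {zero}  m≤t e lt le = meet-rising m refl m≤t e lt le
      rest {suc s} s+m<t e lt le = meet-falling s+m<t (trans (Bool.not-injective e) (≡-sym (Bool.not-involutive b))) lt le

    meet : ∀ {b t p s s′} → m + m < t → s < s′ → s′ ≤ m → Meet p (rounds t b) s s′
    meet {b} {t} {p} {s} 2m<t s<s′ s′≤ with parity s Bool.≟ b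
    ... | yes e = meet-rising (m ∸ s) (m+[n∸m]≡n s≤m) (≤-trans (m∸n≤m m s) (≤-trans (m≤m+n m m) (<⇒≤ 2m<t))) e s<s′ s′≤
      where s≤m = <⇒≤ (<-≤-trans s<s′ s′≤)
    ... | no ne = meet-falling (≤-<-trans (+-monoˡ-≤ m s≤m) 2m<t) (Bool.¬-not ne) s<s′ s′≤
      where s≤m = <⇒≤ (<-≤-trans s<s′ s′≤)

    -- Counting matchings, and the bound

    length-sweep : ∀ b k → length (sweep b k) ≡ k * 3
    length-sweep b zero    = refl
    length-sweep b (suc k) = trans (length-++ (sweep b k)) (trans (cong₂ _+_ (length-sweep b k) (length-class b k)) (+-comm (k * 3) 3))

    length-rounds : ∀ t b → length (rounds t b) ≡ t * (K * 3)
    length-rounds zero    b = refl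
    length-rounds (suc t) b = trans (length-++ (round b))
      (cong₂ _+_ (length-sweep b K) (length-rounds t (not b)))

    m<n : m < n
    m<n = subst₂ _≤_ (cong suc (length-map tgt ls)) (length-tabulate {n = n} id) (Unique-⊆⇒length≤ distinct (λ _ → ∈-allFin _))

    -- The line has `suc m` distinct vertices, so `m < n` and `n + n` exceeds the `m + m` required
    -- by `meet`.
    strategy : List (Matching G)
    strategy = rounds (n + n) true

    isStrategy : (∀ v → v ∈ trail r ls) → IsAcquaintanceStrategy G strategy
    isStrategy all∈ a a′ a≢a′ = go (∈-nth (all∈ a)) (∈-nth (all∈ a′))
      where
      bound : ∀ {s} → s < length (trail r ls) → s ≤ m
      bound {s} (s≤s q) = subst (s ≤_) (length-map tgt ls) q
      2m< : m + m < n + n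
      2m< = +-mono-< m<n m<n
      flip : ∀ {q x y} → AcquaintedIn G q x y → AcquaintedIn G q y x
      flip (u , v , adj , e , e′) = v , u , sym G adj , e′ , e
      go : (∃ λ s → s < length (trail r ls) × vert s ≡ a) → (∃ λ s → s < length (trail r ls) × vert s ≡ a′) →
        Any (λ p → AcquaintedIn G p a a′) (placements id strategy)
      go (s , s< , refl) (s′ , s′< , refl) with <-cmp s s′
      ... | tri< lt _ _   = meet {p = id} 2m< lt (bound s′<)
      ... | tri≈ _ refl _ = contradiction refl a≢a′
      ... | tri> _ _ gt   = Any.map flip (meet {p = id} 2m< gt (bound s<))

  -- An edge forces the maximal degree to be at least 1, so `suc Δ` is at most `Δ + Δ`; this leaves
  -- 12 in place of 20.
  has-edge⇒short : ∀ {u v} → Adj G u v → (n + n) * (suc (maxDegree G) * 3) ≤ 20 * maxDegree G * n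
  has-edge⇒short {u} {v} u∼v = begin
    (n + n) * (suc Δ * 3)   ≤⟨ *-monoʳ-≤ (n + n) (*-monoˡ-≤ 3 (+-monoˡ-≤ Δ Δ≥1)) ⟩
    (n + n) * ((Δ + Δ) * 3) ≡⟨ solve 2 (λ n Δ → (n :+ n) :* ((Δ :+ Δ) :* con 3) := con 12 :* Δ :* n) refl n Δ ⟩
    12 * Δ * n              ≤⟨ *-monoˡ-≤ n (*-monoˡ-≤ Δ (m≤m+n 12 8)) ⟩
    20 * Δ * n              ∎
    where
    open ≤-Reasoning
    open +-*-Solver
    Δ = maxDegree G
    Δ≥1 : 1 ≤ Δ
    Δ≥1 = neighbours≤maxDegree ([] ∷ []) (u∼v ∷ [])

  acquaintance : ∀ {r w} → Connected G → Adj G r w → ACAtMost G (20 * maxDegree G * n)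
  acquaintance conn r∼w =
    let _ , S , all∈ = spanning conn (initial r∼w) in
    Simulate.strategy S , Simulate.isStrategy S all∈ ,
    ≤-trans (≤-reflexive (Simulate.length-rounds S (n + n) true)) (has-edge⇒short r∼w)

theorem2p1 : ∀ {n} (G : Graph n) → Connected G → ACAtMost G (20 * maxDegree G * n)
theorem2p1 {zero}        G conn = [] , (λ ()) , z≤n
theorem2p1 {suc zero}    G conn = [] , (λ { zero zero 0≢0 → contradiction refl 0≢0 }) , z≤n
theorem2p1 {suc (suc n)} G conn with conn zero (suc zero)
-- A path between two different vertices is not empty; its first edge serves as the initial link.
... | 0∼w ◅ _ = acquaintance G conn 0∼w
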